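{- Let $G$ be a simple connected graph on the vertex set $[n]$ with $\tau$ spanning trees, let $L$ be its Laplacian matrix, and let $L(n)\in\mathbb{Z}^{n\times(n-1)}$ be $L$ with its $n$-th column deleted. Let $\mathcal{P}_G$ be the Laplacian simplex of $G$, with vertices $\mathbf{v}_1,\dots,\mathbf{v}_n$ (the rows of $L(n)$, in order). Then \[ \Lambda(\mathcal{P}_G)=\left\{\frac{\mathbf{x}}{n\tau}\;\middle|\;\mathbf{x}\in\mathbb{Z}^n,\ 0\le x_i<n\tau \text{ for all } i,\ \mathbf{x}\cdot[L(n)\mid \mathbb{1}]\equiv \mathbf{0}\bmod n\tau\right\}. \]
   Context: The Laplacian matrix $L$ of a simple graph on $[n]$ has $L_{ii}=\deg(i)$, $L_{ij}=-1$ if $\{i,j\}$ is an edge and $0$ otherwise. The Laplacian simplex $\mathcal{P}_G$ is the convex hull in $\mathbb{R}^{n-1}$ of the rows of $L(n)$ (it is an $(n-1)$-simplex). $[L(n)\mid\mathbb{1}]\in\mathbb{Z}^{n\times n}$ is $L(n)$ with a column of all ones appended; vectors are row vectors. For a lattice simplex $\mathcal{P}$ with ordered vertices $\mathbf{v}_1,\dots,\mathbf{v}_{d+1}\in\mathbb{Z}^d$, $\Lambda(\mathcal{P})$ is the set of $\lambda=(\lambda_1,\dots,\lambda_{d+1})$ with $0\le\lambda_i<1$ such that $\sum_i\lambda_i(\mathbf{v}_i,1)\in\mathbb{Z}^{d+1}$ (these sums are the lattice points of the fundamental parallelepiped of $\mathcal{P}$).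
   Formalization: The coefficient vectors λ in Λ(P_G) are taken to be rational rather than real; the equality of sets is stated for rational vectors λ. -}

module Defs where

open import Data.Bool using (Bool; true; false; if_then_else_)
open import Data.Nat as ℕ using (ℕ; zero; suc)
open import Data.Integer as ℤ using (ℤ; +_; -[1+_])
open import Data.Integer.Divisibility as ℤD using ()
open import Data.Rational as ℚ using (ℚ; 0ℚ; 1ℚ)
open import Data.Fin using (Fin; inject₁; _≟_)
open import Data.Vec using (Vec; lookup; tabulate; _∷ʳ_)
open import Data.List using (List; []; _∷_; length; _++_; [_])
open import Data.List.Relation.Unary.All using (All)
open import Data.List.Relation.Unary.Unique.Propositional using (Unique)
open import Data.List.Membership.Propositional using (_∈_)
open import Data.Product using (Σ; _×_; ∃)
open import Data.Unit using (⊤)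
open import Relation.Nullary using (¬_; yes; no)
open import Relation.Binary.PropositionalEquality using (_≡_)

AdjMat : ℕ → Set
AdjMat n = Vec (Vec Bool n) n

Edge : ∀ {n} → AdjMat n → Fin n → Fin n → Set
Edge A i j = lookup (lookup A i) j ≡ true

IsSimple : ∀ {n} → AdjMat n → Set
IsSimple {n} A = (∀ (i j : Fin n) → lookup (lookup A i) j ≡ lookup (lookup A j) i)
               × (∀ (i : Fin n) → lookup (lookup A i) i ≡ false)

data Walk {n} (A : AdjMat n) : Fin n → Fin n → Set where
  here : ∀ {i} → Walk A i i
  step : ∀ {i k j} → Edge A i k → Walk A k j → Walk A i j

IsConnected : ∀ {n} → AdjMat n → Set
IsConnected {n} A = ∀ (i j : Fin n) → Walk A i j

ConsecAdj : ∀ {n} → AdjMat n → List (Fin n) → Set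
ConsecAdj A []            = ⊤
ConsecAdj A (v ∷ [])      = ⊤
ConsecAdj A (v ∷ w ∷ vs)  = Edge A v w × ConsecAdj A (w ∷ vs)

IsCycle : ∀ {n} → AdjMat n → List (Fin n) → Set
IsCycle A []       = Data.Empty.⊥ where import Data.Empty
IsCycle A (v ∷ vs) = Unique (v ∷ vs) × (3 ℕ.≤ length (v ∷ vs))
                   × ConsecAdj A ((v ∷ vs) ++ [ v ])

IsAcyclic : ∀ {n} → AdjMat n → Set
IsAcyclic {n} A = ∀ (c : List (Fin n)) → ¬ IsCycle A c

SubgraphOf : ∀ {n} → AdjMat n → AdjMat n → Set
SubgraphOf {n} T A = ∀ (i j : Fin n) → Edge T i j → Edge A i j

IsSpanningTree : ∀ {n} → AdjMat n → AdjMat n → Set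
IsSpanningTree A T = IsSimple T × SubgraphOf T A × IsConnected T × IsAcyclic T

HasSpanningTreeCount : ∀ {n} → AdjMat n → ℕ → Set
HasSpanningTreeCount {n} A τ =
  Σ (List (AdjMat n)) λ ts →
    Unique ts × All (IsSpanningTree A) ts
    × (∀ T → IsSpanningTree A T → T ∈ ts) × length ts ≡ τ

b2n : Bool → ℕ
b2n true  = 1
b2n false = 0

sumℕ : ∀ {n} → (Fin n → ℕ) → ℕ
sumℕ {zero}  f = 0
sumℕ {suc n} f = f Fin.zero ℕ.+ sumℕ (λ i → f (Fin.suc i)) where import Data.Fin as Fin

deg : ∀ {n} → AdjMat n → Fin n → ℕ
deg A i = sumℕ (λ j → b2n (lookup (lookup A i) j))

Laplacian : ∀ {n} → AdjMat n → Fin n → Fin n → ℤ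
Laplacian A i j with i ≟ j
... | yes _ = + deg A i
... | no  _ = if lookup (lookup A i) j then -[1+ 0 ] else + 0

LnRow : ∀ {m} → AdjMat (suc m) → Fin (suc m) → Vec ℤ m
LnRow A i = tabulate (λ j → Laplacian A i (inject₁ j))

AugRow : ∀ {m} → AdjMat (suc m) → Fin (suc m) → Vec ℤ (suc m)
AugRow A i = LnRow A i ∷ʳ + 1

sumℤ : ∀ {n} → (Fin n → ℤ) → ℤ
sumℤ {zero}  f = + 0
sumℤ {suc n} f = f Fin.zero ℤ.+ sumℤ (λ i → f (Fin.suc i)) where import Data.Fin as Fin

sumℚ : ∀ {n} → (Fin n → ℚ) → ℚ
sumℚ {zero}  f = 0ℚ
sumℚ {suc n} f = f Fin.zero ℚ.+ sumℚ (λ i → f (Fin.suc i)) where import Data.Fin as Fin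

toℚ : ℤ → ℚ
toℚ z = z ℚ./ 1

IsIntegral : ℚ → Set
IsIntegral q = ∃ λ (z : ℤ) → q ≡ toℚ z

InΛ : ∀ {m} → AdjMat (suc m) → (Fin (suc m) → ℚ) → Set
InΛ {m} A λv =
  (∀ i → (0ℚ ℚ.≤ λv i) × (λv i ℚ.< 1ℚ))
  × (∀ (k : Fin (suc m)) → IsIntegral (sumℚ (λ i → λv i ℚ.* toℚ (lookup (AugRow A i) k))))

-- right-hand side: λ = x/(nτ) with x ∈ ℤ^n, 0 ≤ x_i < nτ, x·[L(n)|1] ≡ 0 mod nτ.
-- "λ = x/(nτ)" is written as λ_i · nτ = x_i (nτ ≠ 0 here).
InRHS : ∀ {m} → AdjMat (suc m) → ℕ → (Fin (suc m) → ℚ) → Set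
InRHS {m} A τ λv =
  let N = suc m ℕ.* τ in
  ∃ λ (x : Fin (suc m) → ℤ) →
    (∀ i → (+ 0 ℤ.≤ x i) × (x i ℤ.< + N))
    × (∀ (k : Fin (suc m)) → (+ N) ℤD.∣ sumℤ (λ i → x i ℤ.* lookup (AugRow A i) k))
    × (∀ i → λv i ℚ.* toℚ (+ N) ≡ toℚ (x i))

{-# OPTIONS --safe #-}

-- The point is that nτλ is integral for every λ ∈ Λ. The last coordinate of λ·[L(n) | 1] gives
-- Σ λ_t ∈ ℤ, and the others give λL ∈ ℤⁿ, since the columns of L add up to zero. Hence it suffices
-- that τ(λ_s − λ_t) ∈ ℤ for all s and t, because nτλ_s = Σ_t τ(λ_s − λ_t) + τ Σ_t λ_t.
-- For a spanning tree T, λ_s − λ_t telescopes along the path from s to t in T; an edge ab of T lies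
-- on that path, directed from a to b, exactly when T − ab connects s to a but neither to b nor to t.
-- Summing over the τ trees and collecting the terms with the same forest F = T − ab leaves, for
-- every F that separates s from t, the sum of λ_a − λ_b over all edges ab of G leaving the component
-- χ of s, which is ⟨χ, λL⟩ ∈ ℤ.

module Submission where

open import Defs
open import Data.Bool using (true; false; if_then_else_; _xor_)
import Data.Bool.Properties as Bool
open import Data.Nat as ℕ using (ℕ; zero; suc; _≤_; z≤n; s≤s)
open import Data.Nat.Coprimality as Coprime using (Coprime)
import Data.Nat.Properties as ℕ
open import Data.Integer as ℤ using (ℤ; -[1+_])
import Data.Integer.Divisibility as ℤᵤ
open import Data.Integer.Divisibility.Signed using (divides; ∣⇒∣ᵤ; ∣ᵤ⇒∣)
import Data.Integer.Properties as ℤ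
open import Data.Rational as ℚ using (ℚ; 0ℚ; 1ℚ; _+_; _*_; -_; _-_; mkℚ)
import Data.Rational.Properties as ℚ
open import Data.Rational.Solver using (module +-*-Solver)
import Data.Rational.Unnormalised as ℚᵘ
import Data.Rational.Unnormalised.Properties as ℚᵘ
open import Data.Fin using (Fin; zero; suc; _≟_; inject₁; fromℕ)
open import Data.Fin.Properties using (any?; all?)
open import Data.Fin.Relation.Unary.Top using (view; ‵fromℕ; ‵inject₁)
open import Data.Vec using (Vec; []; _∷_; lookup; tabulate; _∷ʳ_)
import Data.Vec.Properties as Vec
open import Data.Vec.Properties using (lookup∘tabulate; tabulate∘lookup; tabulate-cong)
open import Data.List using (List; []; _∷_; length; _++_; [_]; filter; allFin; map; foldr; cartesianProduct; cartesianProductWith)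
open import Data.List.Properties using (length-filter; length-tabulate; map-∘)
import Data.List.Membership.DecPropositional as DecMembership
open import Data.List.Membership.Propositional using (_∈_)
open import Data.List.Membership.Propositional.Properties
  using (∈-allFin; ∈-filter⁺; ∈-filter⁻; ∈-map⁺; ∈-length; ∈-cartesianProduct⁺; ∈-cartesianProductWith⁺)
open import Data.List.Membership.Propositional.Properties.WithK using (unique∧set⇒bag)
open import Data.List.Relation.Binary.BagAndSetEquality using (∼bag⇒↭)
open import Data.List.Relation.Binary.Permutation.Propositional using (_↭_; ↭⇒↭ₛ)
import Data.List.Relation.Binary.Permutation.Propositional.Properties as ↭
import Data.List.Relation.Binary.Permutation.Setoid.Properties as ↭ₛ
open import Data.List.Relation.Unary.All as All using (All; []; _∷_)
open import Data.List.Relation.Unary.All.Properties using (¬Any⇒All¬)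
open import Data.List.Relation.Unary.AllPairs using ([]; _∷_)
open import Data.List.Relation.Unary.Any using (here; there)
open import Data.List.Relation.Unary.Unique.Propositional using (Unique)
import Data.List.Relation.Unary.Unique.Propositional.Properties as Unique
open import Data.Empty using (⊥)
open import Data.Product using (∃; _×_; _,_; proj₁; proj₂)
open import Data.Sum using (_⊎_; inj₁; inj₂; [_,_]′)
open import Data.Unit using (tt)
open import Algebra.Properties.CommutativeMonoid.Sum ℚ.+-0-commutativeMonoid
open import Function using (_∘_; id)
open import Function.Bundles using (_⇔_; mk⇔)
open import Relation.Binary.PropositionalEquality hiding ([_])
open import Relation.Nullary using (¬_; Dec; yes; no; does; contradiction)
open import Relation.Nullary.Decidable using (_×-dec_; _⊎-dec_; ¬?; map′; does-⇔; dec-true; dec-false)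

open +-*-Solver using (solve; _:+_; _:-_; _:*_; _:=_)

private variable
  n : ℕ
  M M′ T F : AdjMat n
  i j k a b v x y : Fin n
  xs : List (Fin n)
  P Q X : Set

-- All multiplicities are at most one, so equal membership gives equal bags. Sums over lists are
-- reindexed through this.
unique-↭ : {xs ys : List X} → Unique xs → Unique ys →
           (∀ {x} → x ∈ xs ⇔ x ∈ ys) → xs ↭ ys
unique-↭ xs! ys! eq = ∼bag⇒↭ (unique∧set⇒bag xs! ys! eq)

-- Walks

edge? : (M : AdjMat n) (i j : Fin n) → Dec (Edge M i j)
edge? M i j = lookup (lookup M i) j Bool.≟ true

infixr 5 _◅◅_
_◅◅_ : Walk M i j → Walk M j k → Walk M i k
here     ◅◅ w = w
step e u ◅◅ w = step e (u ◅◅ w)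

bind : (∀ {i j} → Edge M i j → Walk M′ i j) → Walk M i j → Walk M′ i j
bind f here       = here
bind f (step e w) = f e ◅◅ bind f w

edge-walk : Edge M i j → Walk M i j
edge-walk e = step e here

IsSymmetric : AdjMat n → Set
IsSymmetric {n} M = ∀ (i j : Fin n) → lookup (lookup M i) j ≡ lookup (lookup M j) i

edge-sym : IsSymmetric M → Edge M i j → Edge M j i
edge-sym M-sym e = trans (M-sym _ _) e

reverse-walk : IsSymmetric M → Walk M i j → Walk M j i
reverse-walk {M = M} M-sym here       = here
reverse-walk {M = M} M-sym (step e w) = reverse-walk M-sym w ◅◅ edge-walk (edge-sym {M = M} M-sym e)

-- The last index lists the visited vertices with both ends, so that simplicity of a path is
-- `Unique` of that index.
data Path {n} (M : AdjMat n) : Fin n → Fin n → List (Fin n) → Set where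
  stop : ∀ i → Path M i i (i ∷ [])
  step : ∀ {i k j xs} → Edge M i k → Path M k j xs → Path M i j (i ∷ xs)

path⇒walk : Path M i j xs → Walk M i j
path⇒walk (stop _)      = here
path⇒walk (step e p) = step e (path⇒walk p)

path-suffix : Path M i j xs → Unique xs → v ∈ xs → ∃ λ ys → Unique ys × Path M v j ys
path-suffix p@(stop _)    xs!       (here refl) = _ , xs! , p
path-suffix p@(step _ _) xs!       (here refl) = _ , xs! , p
path-suffix (step _ p)   (_ ∷ xs!) (there v∈)  = path-suffix p xs! v∈

module _ {n : ℕ} where
  open DecMembership (_≟_ {n}) using () renaming (_∈?_ to _∈ᵛ?_) public

-- Loop erasure: if the new first vertex already occurs on the path, the part of the path starting
-- there replaces the whole.
walk⇒path : Walk M i j → ∃ λ xs → Unique xs × Path M i j xs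
walk⇒path here = _ , [] ∷ [] , (stop _)
walk⇒path (step {i} e w) with walk⇒path w
... | xs , xs! , p with i ∈ᵛ? xs
...   | yes i∈xs = path-suffix p xs! i∈xs
...   | no  i∉xs = _ , ¬Any⇒All¬ xs i∉xs ∷ xs! , step e p

unique-length≤ : {xs : List (Fin n)} → Unique xs → length xs ≤ n
unique-length≤ {n} {xs} xs! = begin
  length xs                            ≡⟨ ↭.↭-length (unique-↭ xs! (Unique.filter⁺ (_∈ᵛ? xs) (Unique.allFin⁺ n)) eq) ⟩
  length (filter (_∈ᵛ? xs) (allFin n)) ≤⟨ length-filter (_∈ᵛ? xs) (allFin n) ⟩
  length (allFin n)                    ≡⟨ length-tabulate id ⟩
  n                                    ∎
  where
  open ℕ.≤-Reasoning
  eq : ∀ {x} → x ∈ xs ⇔ x ∈ filter (_∈ᵛ? xs) (allFin n)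
  eq = mk⇔ (∈-filter⁺ (_∈ᵛ? xs) (∈-allFin _)) (proj₂ ∘ ∈-filter⁻ (_∈ᵛ? xs) {xs = allFin n})

-- Exhaustive search of bounded depth. The bound counts vertices, so `zero` admits no path at all.
path-within? : (M : AdjMat n) (k : ℕ) (i j : Fin n) → Dec (∃ λ xs → Path M i j xs × length xs ≤ k)
path-within? M zero i j = no λ { (_ , stop _ , ()) ; (_ , step _ _ , ()) }
path-within? M (suc k) i j with i ≟ j
... | yes refl = yes (_ , stop i , s≤s z≤n)
... | no  i≢j  = map′
  (λ (v , e , xs , p , len) → i ∷ xs , step e p , s≤s len)
  (λ { (_ , stop _ , _) → contradiction refl i≢j
     ; (_ , step e p , s≤s len) → _ , e , _ , p , len })
  (any? λ v → edge? M i v ×-dec path-within? M k v j)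

-- Loop erasure bounds the search: a simple path has at most n vertices.
walk? : (M : AdjMat n) (i j : Fin n) → Dec (Walk M i j)
walk? {n} M i j = map′
  (λ (_ , p , _) → path⇒walk p)
  (λ w → let xs , xs! , p = walk⇒path w in xs , p , unique-length≤ xs!)
  (path-within? M n i j)

connected? : (M : AdjMat n) → Dec (IsConnected M)
connected? M = all? λ i → all? λ j → walk? M i j

-- Edge deletion

Same : Fin n → Fin n → Fin n → Fin n → Set
Same a b i j = (i ≡ a × j ≡ b) ⊎ (i ≡ b × j ≡ a)

same? : (a b i j : Fin n) → Dec (Same a b i j)
same? a b i j = (i ≟ a ×-dec j ≟ b) ⊎-dec (i ≟ b ×-dec j ≟ a)

same-flip : Same a b i j → Same a b j i
same-flip (inj₁ (p , q)) = inj₂ (q , p)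
same-flip (inj₂ (p , q)) = inj₁ (q , p)

-- Xor deletes the edge ab when it is present and inserts it otherwise. This makes the operation an
-- involution, along which sums over all matrices are later reindexed.
toggle : AdjMat n → Fin n → Fin n → AdjMat n
toggle M a b = tabulate λ i → tabulate λ j → does (same? a b i j) xor lookup (lookup M i) j

lookup-toggle : (M : AdjMat n) (a b i j : Fin n) →
  lookup (lookup (toggle M a b) i) j ≡ does (same? a b i j) xor lookup (lookup M i) j
lookup-toggle M a b i j = trans
  (cong (λ r → lookup r j) (lookup∘tabulate _ i))
  (lookup∘tabulate _ j)

AdjMat-ext : (∀ i j → lookup (lookup M i) j ≡ lookup (lookup M′ i) j) → M ≡ M′
AdjMat-ext {M = M} {M′} eq = begin
  M                    ≡⟨ tabulate∘lookup M ⟨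
  tabulate (lookup M)  ≡⟨ tabulate-cong row ⟩
  tabulate (lookup M′) ≡⟨ tabulate∘lookup M′ ⟩
  M′                   ∎
  where
  open ≡-Reasoning
  row : ∀ i → lookup M i ≡ lookup M′ i
  row i = trans (sym (tabulate∘lookup _)) (trans (tabulate-cong (eq i)) (tabulate∘lookup _))

xor-involutive : ∀ c d → c xor (c xor d) ≡ d
xor-involutive true  true  = refl
xor-involutive true  false = refl
xor-involutive false d     = refl

toggle-involutive : (M : AdjMat n) (a b : Fin n) → toggle (toggle M a b) a b ≡ M
toggle-involutive M a b = AdjMat-ext λ i j → begin
  _ ≡⟨ lookup-toggle (toggle M a b) a b i j ⟩
  _ ≡⟨ cong (does (same? a b i j) xor_) (lookup-toggle M a b i j) ⟩
  _ ≡⟨ xor-involutive (does (same? a b i j)) _ ⟩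
  _ ∎
  where open ≡-Reasoning

toggle-symmetric : IsSymmetric M → IsSymmetric (toggle M a b)
toggle-symmetric {M = M} {a} {b} M-sym i j = begin
  _ ≡⟨ lookup-toggle M a b i j ⟩
  _ ≡⟨ cong₂ _xor_ (does-⇔ (mk⇔ same-flip same-flip) (same? a b i j) (same? a b j i)) (M-sym i j) ⟩
  _ ≡⟨ lookup-toggle M a b j i ⟨
  _ ∎
  where open ≡-Reasoning

-- F = T - ab stated edgewise, so that iterated deletions can be compared without equations between
-- matrices.
record Deletes {n} (T : AdjMat n) (a b : Fin n) (F : AdjMat n) : Set where
  field
    present : Edge T a b
    into    : ∀ {i j} → Edge F i j → Edge T i j
    avoids  : ∀ {i j} → Edge F i j → ¬ Same a b i j
    back    : ∀ {i j} → Edge T i j → ¬ Same a b i j → Edge F i j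

  bind-into : ∀ {i j} → Walk F i j → Walk T i j
  bind-into = bind (edge-walk ∘ into)

  -- The walk is cut at its first use of ab; what precedes lies in F and ends at a or at b.
  walk-split : ∀ {i j} → Walk T i j → Walk F i j ⊎ Walk F i a ⊎ Walk F i b
  walk-split here = inj₁ here
  walk-split (step {i} {k} e w) with same? a b i k
  ... | yes (inj₁ (refl , refl)) = inj₂ (inj₁ here)
  ... | yes (inj₂ (refl , refl)) = inj₂ (inj₂ here)
  ... | no ¬ab with walk-split w
  ...   | inj₁ u        = inj₁ (step (back e ¬ab) u)
  ...   | inj₂ (inj₁ u) = inj₂ (inj₁ (step (back e ¬ab) u))
  ...   | inj₂ (inj₂ u) = inj₂ (inj₂ (step (back e ¬ab) u))

  -- A walk to a either survives the deletion or is cut at a or b, so F has no components other than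
  -- those of a and b.
  reach-end : IsConnected T → ∀ i → Walk F i a ⊎ Walk F i b
  reach-end T-conn i with walk-split (T-conn i a)
  ... | inj₁ w = inj₁ w
  ... | inj₂ w = w

open Deletes

-- Symmetry makes both orientations of ab present, so the xor clears both.
toggle-deletes : IsSymmetric M → Edge M a b → Deletes M a b (toggle M a b)
toggle-deletes {M = M} {a} {b} M-sym e = record
  { present = e
  ; into    = λ {i} {j} → into′ i j
  ; avoids  = λ {i} {j} → avoids′ i j
  ; back    = λ {i} {j} → back′ i j
  }
  where
  same⇒edge : ∀ {i j} → Same a b i j → Edge M i j
  same⇒edge (inj₁ (refl , refl)) = e
  same⇒edge (inj₂ (refl , refl)) = edge-sym {M = M} M-sym e
  into′ : ∀ i j → Edge (toggle M a b) i j → Edge M i j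
  into′ i j f with same? a b i j
  ... | yes p = same⇒edge p
  ... | no ¬p = trans (sym (trans (lookup-toggle M a b i j) (cong (_xor _) (dec-false (same? a b i j) ¬p)))) f
  avoids′ : ∀ i j → Edge (toggle M a b) i j → ¬ Same a b i j
  avoids′ i j f p with trans (sym f) (trans (lookup-toggle M a b i j)
                         (cong₂ _xor_ (dec-true (same? a b i j) p) (same⇒edge p)))
  ... | ()
  back′ : ∀ i j → Edge M i j → ¬ Same a b i j → Edge (toggle M a b) i j
  back′ i j f ¬p = trans (lookup-toggle M a b i j)
    (cong₂ _xor_ (dec-false (same? a b i j) ¬p) f)

toggle-present : ¬ Edge M a b → Edge (toggle M a b) a b
toggle-present {M = M} {a} {b} ¬e = trans (lookup-toggle M a b a b)
  (cong₂ _xor_ (dec-true (same? a b a b) (inj₁ (refl , refl))) (Bool.¬-not ¬e))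

-- Acyclicity as the absence of non-bridges

consec-mono : (∀ {i j} → Edge M i j → Edge M′ i j) → ∀ xs → ConsecAdj M xs → ConsecAdj M′ xs
consec-mono f []           c       = tt
consec-mono f (_ ∷ [])     c       = tt
consec-mono f (_ ∷ _ ∷ xs) (e , c) = f e , consec-mono f (_ ∷ xs) c

path-close : Path M i j xs → Edge M j v → ConsecAdj M (xs ++ [ v ])
path-close (stop _)                   f = f , tt
path-close (step e p@(stop _))      f = e , path-close p f
path-close (step e p@(step _ _))   f = e , path-close p f

path-mono : (∀ {i j} → Edge M i j → Edge M′ i j) → Path M i j xs → Path M′ i j xs
path-mono f (stop i)   = stop i
path-mono f (step e p) = step (f e) (path-mono f p)

-- Shrink the walk to a simple path from y to x. One vertex would make xy a loop, two vertices would
-- use the deleted edge, and a longer path closes up with xy to a cycle.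
acyclic⇒bridge : IsSimple T → IsAcyclic T → Deletes T x y F → ¬ Walk F y x
acyclic⇒bridge {x = x} (_ , T-loopless) T-acyclic del w with walk⇒path w
... | _ , _ , stop _ with trans (sym (present del)) (T-loopless x)
...   | ()
acyclic⇒bridge _ _ del _ | _ , _ , step e (stop _) = avoids del e (inj₂ (refl , refl))
acyclic⇒bridge _ T-acyclic del _ | xs@(_ ∷ _ ∷ _ ∷ _) , xs! , p@(step _ (step _ _)) =
  T-acyclic xs (xs! , s≤s (s≤s (s≤s z≤n)) , path-close (path-mono (into del) p) (present del))

-- Each edge of the chain starts at a vertex other than a and b, hence is not ab. The last vertex v
-- is unrestricted, as it will be an end of the deleted edge.
chain-walk : Deletes T a b F → ∀ x xs → All (λ i → i ≢ a × i ≢ b) (x ∷ xs) →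
             ConsecAdj T (x ∷ xs ++ [ v ]) → Walk F x v
chain-walk del x []       ((x≢a , x≢b) ∷ _)  (e , _) =
  edge-walk (back del e [ x≢a ∘ proj₁ , x≢b ∘ proj₁ ]′)
chain-walk del x (y ∷ ys) ((x≢a , x≢b) ∷ ps) (e , c) =
  step (back del e [ x≢a ∘ proj₁ , x≢b ∘ proj₁ ]′) (chain-walk del y ys ps c)

-- A cycle without its first edge v₀v₁ is a walk from v₁ back to v₀ in the graph with that edge
-- deleted.
bridges⇒acyclic : IsSymmetric T → (∀ x y → Edge T x y → ¬ Walk (toggle T x y) y x) → IsAcyclic T
bridges⇒acyclic {T = T} T-sym bridge (v₀ ∷ []) (_ , s≤s () , _)
bridges⇒acyclic {T = T} T-sym bridge (v₀ ∷ _ ∷ []) (_ , s≤s (s≤s ()) , _)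
bridges⇒acyclic {T = T} T-sym bridge (v₀ ∷ v₁ ∷ v₂ ∷ vs)
  (((v₀≢v₁ ∷ v₀≢v₂ ∷ v₀∉vs) ∷ (v₁≢v₂ ∷ v₁∉vs) ∷ _) , _ , (e₀ , e₁ , c)) =
  bridge v₀ v₁ e₀ (step (back del e₁ ¬same) (chain-walk del v₂ vs rest c))
  where
  del = toggle-deletes {M = T} T-sym e₀
  ¬same : ¬ Same v₀ v₁ v₁ v₂
  ¬same (inj₁ (p , _)) = v₀≢v₁ (sym p)
  ¬same (inj₂ (_ , p)) = v₀≢v₂ (sym p)
  rest : All (λ i → i ≢ v₀ × i ≢ v₁) (v₂ ∷ vs)
  rest = All.zipWith (λ (p , q) → p ∘ sym , q ∘ sym) (v₀≢v₂ ∷ v₀∉vs , v₁≢v₂ ∷ v₁∉vs)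

-- Spanning trees

module _ {A : AdjMat n} (A-simple : IsSimple A) (A-conn : IsConnected A) where

  PrunedAt : AdjMat n → List (Fin n × Fin n) → Set
  PrunedAt M ps = ∀ {a b} → (a , b) ∈ ps → Edge M a b → ¬ IsConnected (toggle M a b)

  -- Greedy deletion: an edge is removed when the graph stays connected without it. The edges kept
  -- are bridges, and they remain so when further edges disappear.
  prune : ∀ ps → ∃ λ M → IsSimple M × SubgraphOf M A × IsConnected M × PrunedAt M ps
  prune [] = A , A-simple , (λ _ _ e → e) , A-conn , λ ()
  prune ((a , b) ∷ ps) with prune ps
  ... | M , M-simple , M⊆A , M-conn , pruned with edge? M a b
  ...   | no ¬e = M , M-simple , M⊆A , M-conn ,
                  λ { (here refl) f → contradiction f ¬e ; (there q) → pruned q }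
  ...   | yes e with connected? (toggle M a b)
  ...     | no ¬c = M , M-simple , M⊆A , M-conn ,
                    λ { (here refl) _ → ¬c ; (there q) → pruned q }
  ...     | yes c = toggle M a b , (F-sym , F-loopless) , (λ i j → M⊆A i j ∘ into del) , c , pruned′
    where
    del = toggle-deletes {M = M} (proj₁ M-simple) e
    F-sym = toggle-symmetric {M = M} (proj₁ M-simple)
    F-loopless : ∀ i → lookup (lookup (toggle M a b) i) i ≡ false
    F-loopless i with lookup (lookup (toggle M a b) i) i in f
    ... | false = refl
    ... | true  = trans (sym (into del f)) (proj₂ M-simple i)
    pruned′ : PrunedAt (toggle M a b) ((a , b) ∷ ps)
    pruned′ (here refl) f _  = avoids del f (inj₁ (refl , refl))
    -- Deleting the earlier edge from M leaves a supergraph of what it leaves of `toggle M a b`. If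
    -- the latter were connected, so would the former be, against `pruned q`.
    pruned′ (there q)   f c′ = pruned q (into del f) λ i j → bind
      (λ g → edge-walk (back del₁ (into del (into del₂ g)) (avoids del₂ g))) (c′ i j)
      where
      del₁ = toggle-deletes {M = M} (proj₁ M-simple) (into del f)
      del₂ = toggle-deletes {M = toggle M a b} F-sym f

  -- Pruning at all pairs leaves a connected graph all of whose edges are bridges. This gives τ > 0.
  spanning-tree-exists : ∃ (IsSpanningTree A)
  spanning-tree-exists with prune (cartesianProduct (allFin n) (allFin n))
  ... | M , M-simple , M⊆A , M-conn , pruned =
    M , M-simple , M⊆A , M-conn , bridges⇒acyclic (proj₁ M-simple) bridge
    where
    bridge : ∀ x y → Edge M x y → ¬ Walk (toggle M x y) y x
    -- Were xy not a bridge, every use of it could be rerouted along `w`, and M without xy would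
    -- stay connected.
    bridge x y e w = pruned (∈-cartesianProduct⁺ (∈-allFin x) (∈-allFin y)) e
      λ i j → bind reroute (M-conn i j)
      where
      F-sym = toggle-symmetric {M = M} (proj₁ M-simple)
      reroute : ∀ {i j} → Edge M i j → Walk (toggle M x y) i j
      reroute {i} {j} f with same? x y i j
      ... | yes (inj₁ (refl , refl)) = reverse-walk F-sym w
      ... | yes (inj₂ (refl , refl)) = w
      ... | no ¬s = edge-walk (back (toggle-deletes {M = M} (proj₁ M-simple) e) f ¬s)

-- In M = T₀ − e₀, reconnecting the two components by any other edge e gives a spanning tree again.
module _ {A M : AdjMat n} (A-simple : IsSimple A) where

  spanning-tree-exchange : ∀ {a₀ b₀ a b s} → Edge (toggle M a₀ b₀) a₀ b₀ → IsSpanningTree A (toggle M a₀ b₀) →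
    Edge A a b → Walk M s a → ¬ Walk M s b → IsSpanningTree A (toggle M a b)
  spanning-tree-exchange {a₀} {b₀} {a} {b} {s} e₀ (T₀-simple@(T₀-sym , T₀-loopless) , T₀⊆A , T₀-conn , T₀-acyclic) eA w ¬w =
    (T-sym , T-loopless) , T′⊆A , T-conn , bridges⇒acyclic T-sym bridge
    where
    T₀ = toggle M a₀ b₀
    T′  = toggle M a b
    M-sym : IsSymmetric M
    M-sym = subst IsSymmetric (toggle-involutive M a₀ b₀) (toggle-symmetric {M = T₀} T₀-sym)
    T-sym : IsSymmetric T′
    T-sym = toggle-symmetric {M = M} M-sym
    del₀ : Deletes T₀ a₀ b₀ M
    del₀ = subst (Deletes T₀ a₀ b₀) (toggle-involutive M a₀ b₀) (toggle-deletes {M = T₀} T₀-sym e₀)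
    del : Deletes T′ a b M
    del = subst (Deletes T′ a b) (toggle-involutive M a b)
      (toggle-deletes {M = T′} T-sym (toggle-present {M = M} λ e → ¬w (w ◅◅ edge-walk e)))
    T′⊆A : SubgraphOf T′ A
    T′⊆A i j f with same? a b i j
    ... | yes (inj₁ (refl , refl)) = eA
    ... | yes (inj₂ (refl , refl)) = edge-sym {M = A} (proj₁ A-simple) eA
    ... | no ¬s = T₀⊆A i j (into del₀ (back del f ¬s))
    T-loopless : ∀ i → lookup (lookup T′ i) i ≡ false
    T-loopless i with lookup (lookup T′ i) i in f
    ... | false = refl
    ... | true  = trans (sym (T′⊆A i i f)) (proj₂ A-simple i)
    a≁b : ¬ Walk M a b
    a≁b u = ¬w (w ◅◅ u)
    rev : ∀ {i j} → Walk M i j → Walk M j i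
    rev = reverse-walk M-sym
    -- M has no components beyond those of a₀ and b₀, and a, b lie in different ones. Hence i lies
    -- with a, or with b and then the edge ba leads on to a.
    reach : ∀ i → Walk T′ i a
    reach i with reach-end del₀ T₀-conn i | reach-end del₀ T₀-conn a | reach-end del₀ T₀-conn b
    ... | inj₁ p | inj₁ q | _      = bind-into del (p ◅◅ rev q)
    ... | inj₂ p | inj₂ q | _      = bind-into del (p ◅◅ rev q)
    ... | _      | inj₁ q | inj₁ r = contradiction (q ◅◅ rev r) a≁b
    ... | _      | inj₂ q | inj₂ r = contradiction (q ◅◅ rev r) a≁b
    ... | inj₁ p | inj₂ q | inj₁ r = bind-into del (p ◅◅ rev r) ◅◅ edge-walk (edge-sym {M = T′} T-sym (present del))
    ... | inj₂ p | inj₁ q | inj₂ r = bind-into del (p ◅◅ rev r) ◅◅ edge-walk (edge-sym {M = T′} T-sym (present del))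
    T-conn : IsConnected T′
    T-conn i j = reach i ◅◅ reverse-walk T-sym (reach j)
    bridge : ∀ x y → Edge T′ x y → ¬ Walk (toggle T′ x y) y x
    bridge x y f u with same? a b x y
    ... | yes (inj₁ (refl , refl)) = a≁b (rev (subst (λ N → Walk N y x) (toggle-involutive M a b) u))
    ... | yes (inj₂ (refl , refl)) = a≁b (bind (λ g → edge-walk (back del (into delF g) (avoids delF g ∘ flip-same))) u)
      where
      delF = toggle-deletes {M = T′} T-sym f
      flip-same : ∀ {i j} → Same a b i j → Same b a i j
      flip-same (inj₁ p) = inj₂ p
      flip-same (inj₂ p) = inj₁ p
    -- Here xy is an edge of M, hence of T₀, where it is a bridge; so it is a bridge of M too.
    ... | no ¬s = main
      where
      fM : Edge M x y
      fM = back del f ¬s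
      delT : Deletes T′ x y (toggle T′ x y)
      delT = toggle-deletes {M = T′} T-sym f
      delM : Deletes M x y (toggle M x y)
      delM = toggle-deletes {M = M} M-sym fM
      delT₀ : Deletes T₀ x y (toggle T₀ x y)
      delT₀ = toggle-deletes {M = T₀} T₀-sym (into del₀ fM)
      ¬M : ¬ Walk (toggle M x y) y x
      ¬M v = acyclic⇒bridge T₀-simple T₀-acyclic delT₀
        (bind (λ g → edge-walk (back delT₀ (into del₀ (into delM g)) (avoids delM g))) v)
      abT : Edge (toggle T′ x y) a b
      abT = back delT (present del) λ { (inj₁ (refl , refl)) → ¬s (inj₁ (refl , refl)) ; (inj₂ (refl , refl)) → ¬s (inj₂ (refl , refl)) }
      -- The two deletions commute: removing ab from T′ - xy gives M - xy.
      del′ : Deletes (toggle T′ x y) a b (toggle M x y)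
      del′ = record
        { present = abT
        ; into    = λ g → back delT (into del (into delM g)) (avoids delM g)
        ; avoids  = λ g → avoids del (into delM g)
        ; back    = λ g ¬ab → back delM (back del (into delT g) ¬ab) (avoids delT g)
        }
      rw : ∀ {i j} → Walk (toggle M x y) i j → Walk (toggle M x y) j i
      rw = reverse-walk (toggle-symmetric {M = M} M-sym)
      lift : ∀ {i j} → Walk (toggle M x y) i j → Walk M i j
      lift = bind-into delM
      -- The walk `u` is cut at ab from both of its ends. If x and y reach the same end of ab, they
      -- are joined in M - xy; if they reach different ends, a and b are joined in M through xy.
      main : ⊥
      main with walk-split del′ u | walk-split del′ (reverse-walk (toggle-symmetric {M = T′} T-sym) u)
      ... | inj₁ v        | _             = ¬M v
      ... | _             | inj₁ v        = ¬M (rw v)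
      ... | inj₂ (inj₁ p) | inj₂ (inj₁ q) = ¬M (p ◅◅ rw q)
      ... | inj₂ (inj₂ p) | inj₂ (inj₂ q) = ¬M (p ◅◅ rw q)
      ... | inj₂ (inj₁ p) | inj₂ (inj₂ q) = a≁b (rev (lift p) ◅◅ step (edge-sym {M = M} M-sym fM) (lift q))
      ... | inj₂ (inj₂ p) | inj₂ (inj₁ q) = a≁b (rev (lift q) ◅◅ step fM (lift p))

-- Rational integers

coprime-1 : ∀ m → Coprime m 1
coprime-1 m = Coprime.sym (Coprime.1-coprimeTo m)

-- `_/_` normalises by a gcd and does not reduce on a variable. The form with denominator 1 exposes
-- the numerator for injectivity and order.
toℚ≡mkℚ : ∀ z → toℚ z ≡ mkℚ z 0 (coprime-1 ℤ.∣ z ∣)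
toℚ≡mkℚ (ℤ.+ m)    = ℚ.normalize-coprime {m} {0} (coprime-1 m)
toℚ≡mkℚ -[1+ m ] = cong -_ (ℚ.normalize-coprime {suc m} {0} (coprime-1 (suc m)))

toℚᵘ-toℚ : ∀ z → ℚ.toℚᵘ (toℚ z) ℚᵘ.≃ ℚᵘ.mkℚᵘ z 0
toℚᵘ-toℚ z = ℚ.toℚᵘ-fromℚᵘ (ℚᵘ.mkℚᵘ z 0)

toℚ-+ : ∀ x y → toℚ (x ℤ.+ y) ≡ toℚ x + toℚ y
toℚ-+ x y = ℚ.toℚᵘ-injective (begin
  ℚ.toℚᵘ (toℚ (x ℤ.+ y))                 ≈⟨ toℚᵘ-toℚ (x ℤ.+ y) ⟩
  ℚᵘ.mkℚᵘ (x ℤ.+ y) 0                    ≡⟨ cong (λ z → ℚᵘ.mkℚᵘ z 0) (cong₂ ℤ._+_ (ℤ.*-identityʳ x) (ℤ.*-identityʳ y)) ⟨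
  ℚᵘ.mkℚᵘ x 0 ℚᵘ.+ ℚᵘ.mkℚᵘ y 0           ≈⟨ ℚᵘ.+-cong (toℚᵘ-toℚ x) (toℚᵘ-toℚ y) ⟨
  ℚ.toℚᵘ (toℚ x) ℚᵘ.+ ℚ.toℚᵘ (toℚ y)     ≈⟨ ℚ.toℚᵘ-homo-+ (toℚ x) (toℚ y) ⟨
  ℚ.toℚᵘ (toℚ x + toℚ y)                 ∎)
  where open ℚᵘ.≃-Reasoning

toℚ-* : ∀ x y → toℚ (x ℤ.* y) ≡ toℚ x * toℚ y
toℚ-* x y = ℚ.toℚᵘ-injective (begin
  ℚ.toℚᵘ (toℚ (x ℤ.* y))                 ≈⟨ toℚᵘ-toℚ (x ℤ.* y) ⟩
  ℚᵘ.mkℚᵘ x 0 ℚᵘ.* ℚᵘ.mkℚᵘ y 0           ≈⟨ ℚᵘ.*-cong (toℚᵘ-toℚ x) (toℚᵘ-toℚ y) ⟨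
  ℚ.toℚᵘ (toℚ x) ℚᵘ.* ℚ.toℚᵘ (toℚ y)     ≈⟨ ℚ.toℚᵘ-homo-* (toℚ x) (toℚ y) ⟨
  ℚ.toℚᵘ (toℚ x * toℚ y)                 ∎)
  where open ℚᵘ.≃-Reasoning

toℚ-neg : ∀ x → toℚ (ℤ.- x) ≡ - toℚ x
toℚ-neg x = ℚ.toℚᵘ-injective (begin
  ℚ.toℚᵘ (toℚ (ℤ.- x))    ≈⟨ toℚᵘ-toℚ (ℤ.- x) ⟩
  ℚᵘ.- ℚᵘ.mkℚᵘ x 0        ≈⟨ ℚᵘ.-‿cong (toℚᵘ-toℚ x) ⟨
  ℚᵘ.- ℚ.toℚᵘ (toℚ x)     ≈⟨ ℚ.toℚᵘ-homo‿- (toℚ x) ⟨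
  ℚ.toℚᵘ (- toℚ x)        ∎)
  where open ℚᵘ.≃-Reasoning

toℚ-injective : ∀ {x y} → toℚ x ≡ toℚ y → x ≡ y
toℚ-injective {x} {y} eq = begin
  x           ≡⟨ cong ℚ.↥_ (toℚ≡mkℚ x) ⟨
  ℚ.↥ (toℚ x) ≡⟨ cong ℚ.↥_ eq ⟩
  ℚ.↥ (toℚ y) ≡⟨ cong ℚ.↥_ (toℚ≡mkℚ y) ⟩
  y           ∎
  where open ≡-Reasoning

toℚ-mono-≤ : ∀ {x y} → x ℤ.≤ y → toℚ x ℚ.≤ toℚ y
toℚ-mono-≤ {x} {y} x≤y
  rewrite toℚ≡mkℚ x | toℚ≡mkℚ y =
  ℚ.*≤* (subst₂ ℤ._≤_ (sym (ℤ.*-identityʳ x)) (sym (ℤ.*-identityʳ y)) x≤y)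

toℚ-mono-< : ∀ {x y} → x ℤ.< y → toℚ x ℚ.< toℚ y
toℚ-mono-< {x} {y} x<y
  rewrite toℚ≡mkℚ x | toℚ≡mkℚ y =
  ℚ.*<* (subst₂ ℤ._<_ (sym (ℤ.*-identityʳ x)) (sym (ℤ.*-identityʳ y)) x<y)

toℚ-cancel-≤ : ∀ {x y} → toℚ x ℚ.≤ toℚ y → x ℤ.≤ y
toℚ-cancel-≤ {x} {y} p = ℤ.≮⇒≥ λ y<x → ℚ.<-irrefl refl (ℚ.<-≤-trans (toℚ-mono-< y<x) p)

toℚ-cancel-< : ∀ {x y} → toℚ x ℚ.< toℚ y → x ℤ.< y
toℚ-cancel-< {x} {y} p = ℤ.≰⇒> λ y≤x → ℚ.<-irrefl refl (ℚ.<-≤-trans p (toℚ-mono-≤ y≤x))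

integral-+ : ∀ {p q} → IsIntegral p → IsIntegral q → IsIntegral (p + q)
integral-+ (x , refl) (y , refl) = x ℤ.+ y , sym (toℚ-+ x y)

integral-* : ∀ {p q} → IsIntegral p → IsIntegral q → IsIntegral (p * q)
integral-* (x , refl) (y , refl) = x ℤ.* y , sym (toℚ-* x y)

integral-neg : ∀ {p} → IsIntegral p → IsIntegral (- p)
integral-neg (x , refl) = ℤ.- x , sym (toℚ-neg x)

integral-sum : {f : Fin n → ℚ} → (∀ i → IsIntegral (f i)) → IsIntegral (sum f)
integral-sum {zero}  int = ℤ.+ 0 , refl
integral-sum {suc n} int = integral-+ (int zero) (integral-sum (int ∘ suc))

-- Sums

sum-neg : (f : Fin n → ℚ) → sum (λ i → - f i) ≡ - sum f
sum-neg {zero}  f = refl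
sum-neg {suc n} f = trans (cong (- f zero +_) (sum-neg (f ∘ suc))) (sym (ℚ.neg-distrib-+ (f zero) (sum (f ∘ suc))))

sum-*ʳ : (f : Fin n → ℚ) (q : ℚ) → sum (λ i → f i * q) ≡ sum f * q
sum-*ʳ {zero}  f q = sym (ℚ.*-zeroˡ q)
sum-*ʳ {suc n} f q = trans (cong (f zero * q +_) (sum-*ʳ (f ∘ suc) q)) (sym (ℚ.*-distribʳ-+ q (f zero) (sum (f ∘ suc))))

sum-zero : {f : Fin n → ℚ} → (∀ i → f i ≡ 0ℚ) → sum f ≡ 0ℚ
sum-zero {n} eq = trans (sum-cong-≗ eq) (sum-replicate-zero n)

sumℚ≡sum : (f : Fin n → ℚ) → sumℚ f ≡ sum f
sumℚ≡sum {zero}  f = refl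
sumℚ≡sum {suc n} f = cong (f zero +_) (sumℚ≡sum (f ∘ suc))

toℚ-sumℤ : (f : Fin n → ℤ) → toℚ (sumℤ f) ≡ sum (toℚ ∘ f)
toℚ-sumℤ {zero}  f = refl
toℚ-sumℤ {suc n} f = trans (toℚ-+ (f zero) (sumℤ (f ∘ suc))) (cong (toℚ (f zero) +_) (toℚ-sumℤ (f ∘ suc)))

-- Iverson brackets

infixr 8 ⟦_⟧_
-- The Iverson bracket of P times q. It turns a sum over a decidable subset into a sum over the
-- whole index type.
⟦_⟧_ : Dec P → ℚ → ℚ
⟦ d ⟧ q = if does d then q else 0ℚ

⟦⟧-yes : (d : Dec P) {q : ℚ} → P → ⟦ d ⟧ q ≡ q
⟦⟧-yes d p = cong (if_then _ else _) (dec-true d p)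

⟦⟧-no : (d : Dec P) {q : ℚ} → ¬ P → ⟦ d ⟧ q ≡ 0ℚ
⟦⟧-no d ¬p = cong (if_then _ else _) (dec-false d ¬p)

⟦⟧-⇔ : (d : Dec P) (e : Dec Q) {q : ℚ} → (P → Q) → (Q → P) → ⟦ d ⟧ q ≡ ⟦ e ⟧ q
⟦⟧-⇔ d e f g = cong (if_then _ else _) (does-⇔ (mk⇔ f g) d e)

⟦⟧-× : (d : Dec P) (e : Dec Q) (q : ℚ) → ⟦ d ×-dec e ⟧ q ≡ ⟦ d ⟧ ⟦ e ⟧ q
⟦⟧-× d e q with does d
... | true  = refl
... | false = refl

⟦⟧-+ : (d : Dec P) (p q : ℚ) → ⟦ d ⟧ (p + q) ≡ ⟦ d ⟧ p + ⟦ d ⟧ q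
⟦⟧-+ d p q with does d
... | true  = refl
... | false = refl

⟦⟧-neg : (d : Dec P) (q : ℚ) → ⟦ d ⟧ (- q) ≡ - ⟦ d ⟧ q
⟦⟧-neg d q with does d
... | true  = refl
... | false = refl

⟦⟧-sum : (d : Dec P) (f : Fin n → ℚ) → ⟦ d ⟧ sum f ≡ sum (λ i → ⟦ d ⟧ f i)
⟦⟧-sum {n = n} d f with does d
... | true  = refl
... | false = sym (sum-replicate-zero n)

⟦⟧-split : (d : Dec P) (q : ℚ) → q ≡ ⟦ d ⟧ q + ⟦ ¬? d ⟧ q
⟦⟧-split d q with does d
... | true  = sym (ℚ.+-identityʳ q)
... | false = sym (ℚ.+-identityˡ q)

integral-⟦⟧ : (d : Dec P) {q : ℚ} → IsIntegral q → IsIntegral (⟦ d ⟧ q)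
integral-⟦⟧ d int with does d
... | true  = int
... | false = ℤ.+ 0 , refl

sum-δ : (x : Fin n) (q : ℚ) → sum (λ i → ⟦ i ≟ x ⟧ q) ≡ q
sum-δ {suc n} zero    q = trans (cong (q +_) (sum-replicate-zero n)) (ℚ.+-identityʳ q)
sum-δ {suc n} (suc x) q = trans (ℚ.+-identityˡ _) (sum-δ x q)

sum-δ₂ : (x y : Fin n) (q : ℚ) → sum (λ i → sum λ j → ⟦ i ≟ x ×-dec j ≟ y ⟧ q) ≡ q
sum-δ₂ x y q = begin
  sum (λ i → sum λ j → ⟦ i ≟ x ×-dec j ≟ y ⟧ q) ≡⟨ sum-cong-≗ (λ i → sum-cong-≗ λ j → ⟦⟧-× (i ≟ x) (j ≟ y) q) ⟩
  sum (λ i → sum λ j → ⟦ i ≟ x ⟧ ⟦ j ≟ y ⟧ q)   ≡⟨ sum-cong-≗ (λ i → ⟦⟧-sum (i ≟ x) λ j → ⟦ j ≟ y ⟧ q) ⟨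
  sum (λ i → ⟦ i ≟ x ⟧ sum λ j → ⟦ j ≟ y ⟧ q)   ≡⟨ sum-δ x _ ⟩
  sum (λ j → ⟦ j ≟ y ⟧ q)                       ≡⟨ sum-δ y q ⟩
  q                                             ∎
  where open ≡-Reasoning

-- Exchanging the order of summation identifies the two halves.
sum-antisym : (f : Fin n → Fin n → ℚ) → sum (λ i → sum λ j → f i j + - f j i) ≡ 0ℚ
sum-antisym f = begin
  sum (λ i → sum λ j → f i j + - f j i)
    ≡⟨ sum-cong-≗ (λ i → trans (∑-distrib-+ (f i) _) (cong (sum (f i) +_) (sum-neg λ j → f j i))) ⟩
  sum (λ i → sum (f i) + - sum λ j → f j i)
    ≡⟨ trans (∑-distrib-+ (λ i → sum (f i)) _) (cong (sum (λ i → sum (f i)) +_) (sum-neg λ i → sum λ j → f j i)) ⟩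
  sum (λ i → sum (f i)) + - sum (λ i → sum λ j → f j i)
    ≡⟨ cong (λ q → q + - sum (λ i → sum λ j → f j i)) (∑-comm f) ⟩
  sum (λ i → sum λ j → f j i) + - sum (λ i → sum λ j → f j i)
    ≡⟨ ℚ.+-inverseʳ (sum λ i → sum λ j → f j i) ⟩
  0ℚ ∎
  where open ≡-Reasoning

-- Sums over lists

Σₗ : List X → (X → ℚ) → ℚ
Σₗ xs f = foldr _+_ 0ℚ (map f xs)

Σₗ-cong : {f g : X → ℚ} (xs : List X) → (∀ {x} → x ∈ xs → f x ≡ g x) → Σₗ xs f ≡ Σₗ xs g
Σₗ-cong []       eq = refl
Σₗ-cong (x ∷ xs) eq = cong₂ _+_ (eq (here refl)) (Σₗ-cong xs (eq ∘ there))

Σₗ-↭ : {xs ys : List X} (f : X → ℚ) → xs ↭ ys → Σₗ xs f ≡ Σₗ ys f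
Σₗ-↭ f p = ↭ₛ.foldr-commMonoid (setoid ℚ) ℚ.+-0-isCommutativeMonoid (↭⇒↭ₛ (↭.map⁺ f p))

Σₗ-filter : {R : X → Set} (R? : ∀ x → Dec (R x)) (xs : List X) (f : X → ℚ) →
            Σₗ (filter R? xs) f ≡ Σₗ xs (λ x → ⟦ R? x ⟧ f x)
Σₗ-filter R? []       f = refl
Σₗ-filter R? (x ∷ xs) f with does (R? x)
... | true  = cong (f x +_) (Σₗ-filter R? xs f)
... | false = trans (Σₗ-filter R? xs f) (sym (ℚ.+-identityˡ _))

Σₗ-sum : (xs : List X) (f : X → Fin n → ℚ) → Σₗ xs (λ x → sum (f x)) ≡ sum (λ i → Σₗ xs λ x → f x i)
Σₗ-sum {n = n} []       f = sym (sum-replicate-zero n)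
Σₗ-sum         (x ∷ xs) f = trans (cong (sum (f x) +_) (Σₗ-sum xs f)) (sym (∑-distrib-+ (f x) _))

Σₗ-const : (xs : List X) (q : ℚ) → Σₗ xs (λ _ → q) ≡ toℚ (ℤ.+ length xs) * q
Σₗ-const []       q = sym (ℚ.*-zeroˡ q)
Σₗ-const (x ∷ xs) q = begin
  q + Σₗ xs (λ _ → q)               ≡⟨ cong₂ _+_ (sym (ℚ.*-identityˡ q)) (Σₗ-const xs q) ⟩
  1ℚ * q + toℚ (ℤ.+ length xs) * q    ≡⟨ ℚ.*-distribʳ-+ q 1ℚ (toℚ (ℤ.+ length xs)) ⟨
  (1ℚ + toℚ (ℤ.+ length xs)) * q      ≡⟨ cong (_* q) (toℚ-+ (ℤ.+ 1) (ℤ.+ length xs)) ⟨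
  toℚ (ℤ.+ suc (length xs)) * q       ∎
  where open ≡-Reasoning

integral-Σₗ : (xs : List X) {f : X → ℚ} → (∀ x → IsIntegral (f x)) → IsIntegral (Σₗ xs f)
integral-Σₗ []       int = ℤ.+ 0 , refl
integral-Σₗ (x ∷ xs) int = integral-+ (int x) (integral-Σₗ xs int)

-- `g` is its own inverse, so it permutes a list that contains every element exactly once.
Σₗ-involution : {xs : List X} (g : X → X) → (∀ x → g (g x) ≡ x) → Unique xs → (∀ x → x ∈ xs) →
                (f : X → ℚ) → Σₗ xs f ≡ Σₗ xs (f ∘ g)
Σₗ-involution {xs = xs} g invol xs! complete f = trans
  (Σₗ-↭ f (unique-↭ xs! (Unique.map⁺ inj xs!) (mk⇔ (λ _ → in-map _) (λ _ → complete _))))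
  (cong (foldr _+_ 0ℚ) (sym (map-∘ xs)))
  where
  inj : ∀ {x y} → g x ≡ g y → x ≡ y
  inj eq = trans (sym (invol _)) (trans (cong g eq) (invol _))
  in-map : ∀ x → x ∈ map g xs
  in-map x = subst (_∈ map g xs) (invol x) (∈-map⁺ g (complete (g x)))

-- Enumeration of all Boolean matrices

allVec : List X → ∀ n → List (Vec X n)
allVec xs zero    = [] ∷ []
allVec xs (suc n) = cartesianProductWith _∷_ xs (allVec xs n)

allVec-complete : {xs : List X} → (∀ x → x ∈ xs) → (v : Vec X n) → v ∈ allVec xs n
allVec-complete complete []      = here refl
allVec-complete complete (x ∷ v) = ∈-cartesianProductWith⁺ _∷_ (complete x) (allVec-complete complete v)

allVec-unique : {xs : List X} → Unique xs → ∀ n → Unique (allVec xs n)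
allVec-unique xs! zero    = [] ∷ []
allVec-unique xs! (suc n) = Unique.cartesianProductWith⁺ _∷_ Vec.∷-injective xs! (allVec-unique xs! n)

-- All Boolean matrices rather than simple graphs only, so that the range is closed under `toggle`
-- for every pair of vertices.
allMat : ∀ n → List (AdjMat n)
allMat n = allVec (allVec (true ∷ false ∷ []) n) n

allMat-complete : (M : AdjMat n) → M ∈ allMat n
allMat-complete = allVec-complete (allVec-complete λ { true → here refl ; false → there (here refl) })

allMat-unique : Unique (allMat n)
allMat-unique {n} = allVec-unique (allVec-unique (((λ ()) ∷ []) ∷ [] ∷ []) n) n

-- Potential differences summed over spanning trees

-- For F = T - ab with T a tree: the path of T from s to v runs through ab from a to b.
Crosses : AdjMat n → (s a b v : Fin n) → Set
Crosses F s a b v = Walk F s a × ¬ Walk F s b × ¬ Walk F s v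

crosses? : (F : AdjMat n) (s a b v : Fin n) → Dec (Crosses F s a b v)
crosses? F s a b v = walk? F s a ×-dec ¬? (walk? F s b) ×-dec ¬? (walk? F s v)

module _ {n} (pot : Fin n → ℚ) where

  -- Contribution of the directed pair (a , b) to the telescoping sum along the path of T from s to
  -- v.
  pathTerm : AdjMat n → (s v a b : Fin n) → ℚ
  pathTerm T s v a b = ⟦ edge? T a b ×-dec crosses? (toggle T a b) s a b v ⟧ (pot a - pot b)

  module _ {A T : AdjMat n} (T-tree : IsSpanningTree A T) (s : Fin n) where
    private
      T-simple  = proj₁ T-tree
      T-sym     = proj₁ T-simple
      T-conn    = proj₁ (proj₂ (proj₂ T-tree))
      T-acyclic = proj₂ (proj₂ (proj₂ T-tree))

      deletes : ∀ {a b} → Edge T a b → Deletes T a b (toggle T a b)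
      deletes = toggle-deletes {M = T} T-sym

      reverse : ∀ {a b i j} → Walk (toggle T a b) i j → Walk (toggle T a b) j i
      reverse {a} {b} = reverse-walk (toggle-symmetric {M = T} {a} {b} T-sym)

      flip : ∀ {x y i j} → Edge T x y → Walk (toggle T y x) i j → Walk (toggle T x y) i j
      flip {x} {y} e = bind λ g → edge-walk (back (deletes e) (into del g) (avoids del g ∘ swap))
        where
        del = deletes (edge-sym {M = T} T-sym e)
        swap : ∀ {i j} → Same x y i j → Same y x i j
        swap (inj₁ p) = inj₂ p
        swap (inj₂ p) = inj₁ p

      -- Otherwise x and y are joined in T - xy, which closes a cycle in T.
      separated : ∀ {x y} → Edge T x y → Walk (toggle T x y) s x → ¬ Walk (toggle T x y) s y
      separated e p q = acyclic⇒bridge T-simple T-acyclic (deletes e) (reverse q ◅◅ p)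

      -- The value at v with the drops along the path from s to v added back. Telescoping amounts to
      -- its being constant, which can be checked edge by edge without extracting the path.
      potential : Fin n → ℚ
      potential v = pot v + sum λ a → sum λ b → pathTerm T s v a b

      -- Moving the end of the path along xy away from s appends the directed edge xy. For any other
      -- contributing pair (a , b), the edge xy survives in T - ab, so x and y lie on the same side.
      pathTerm-step : ∀ {x y} → Edge T x y → Walk (toggle T x y) s x → ∀ a b →
        pathTerm T s y a b ≡ pathTerm T s x a b + ⟦ a ≟ x ×-dec b ≟ y ⟧ (pot x - pot y)
      pathTerm-step {x} {y} e p a b with a ≟ x ×-dec b ≟ y
      ... | yes (refl , refl) = trans
        (⟦⟧-yes (edge? T a b ×-dec crosses? (toggle T a b) s a b b) (e , p , separated e p , separated e p))
        (sym (trans (cong₂ _+_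
          (⟦⟧-no (edge? T a b ×-dec crosses? (toggle T a b) s a b a) λ (_ , _ , _ , ¬p) → ¬p p)
          (⟦⟧-yes (a ≟ a ×-dec b ≟ b) (refl , refl)))
          (ℚ.+-identityˡ (pot a - pot b))))
      ... | no ¬xy = trans
        (⟦⟧-⇔ (edge? T a b ×-dec crosses? (toggle T a b) s a b y) (edge? T a b ×-dec crosses? (toggle T a b) s a b x)
          (λ (f , q , ¬r , ¬u) → f , q , ¬r , λ u → ¬u (u ◅◅ edge-walk (kept f q)))
          (λ (f , q , ¬r , ¬u) → f , q , ¬r , λ u → ¬u (u ◅◅ reverse (edge-walk (kept f q)))))
        (sym (trans (cong (pathTerm T s x a b +_) (⟦⟧-no (a ≟ x ×-dec b ≟ y) ¬xy)) (ℚ.+-identityʳ (pathTerm T s x a b))))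
        where
        -- The pair (a , b) = (y , x) is excluded: s would reach y without using xy, although it
        -- reaches x that way.
        kept : Edge T a b → Walk (toggle T a b) s a → Edge (toggle T a b) x y
        kept f q = back (deletes f) e λ
          { (inj₁ (refl , refl)) → ¬xy (refl , refl)
          ; (inj₂ (refl , refl)) → separated e p (flip e q) }

      potential-edge : ∀ {x y} → Edge T x y → Walk (toggle T x y) s x → potential x ≡ potential y
      potential-edge {x} {y} e p = sym (begin
        pot y + sum (λ a → sum λ b → pathTerm T s y a b)
          ≡⟨ cong (pot y +_) (sum-cong-≗ λ a → trans (sum-cong-≗ (pathTerm-step e p a)) (∑-distrib-+ (pathTerm T s x a) _)) ⟩
        pot y + sum (λ a → sum (pathTerm T s x a) + sum (λ b → ⟦ a ≟ x ×-dec b ≟ y ⟧ (pot x - pot y)))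
          ≡⟨ cong (pot y +_) (∑-distrib-+ (λ a → sum (pathTerm T s x a)) _) ⟩
        pot y + (Σx + sum (λ a → sum (λ b → ⟦ a ≟ x ×-dec b ≟ y ⟧ (pot x - pot y))))
          ≡⟨ cong (λ q → pot y + (Σx + q)) (sum-δ₂ x y _) ⟩
        pot y + (Σx + (pot x - pot y))
          ≡⟨ solve 3 (λ p q r → q :+ (r :+ (p :- q)) := p :+ r) refl (pot x) (pot y) Σx ⟩
        pot x + Σx ∎)
        where
        open ≡-Reasoning
        Σx = sum λ a → sum (pathTerm T s x a)

      -- After the deletion of an edge of T, s stays joined to one of its ends; `potential-edge`
      -- applies from that end to the other.
      potential-walk : ∀ {i j} → Walk T i j → potential i ≡ potential j
      potential-walk here = refl
      potential-walk (step e w) with reach-end (deletes e) T-conn s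
      ... | inj₁ p = trans (potential-edge e p) (potential-walk w)
      ... | inj₂ p = trans (sym (potential-edge e′ (flip e′ p))) (potential-walk w)
        where e′ = edge-sym {M = T} T-sym e

    -- `potential` is constant on the connected T, and at s its sum vanishes because no edge
    -- separates s from itself.
    tree-difference : ∀ t → pot s - pot t ≡ sum λ a → sum λ b → pathTerm T s t a b
    tree-difference t = begin
      pot s - pot t         ≡⟨ cong (_- pot t) (ℚ.+-identityʳ (pot s)) ⟨
      (pot s + 0ℚ) - pot t  ≡⟨ cong (λ q → (pot s + q) - pot t) at-s ⟨
      potential s - pot t   ≡⟨ cong (_- pot t) (potential-walk (T-conn s t)) ⟩
      potential t - pot t   ≡⟨ solve 2 (λ p q → (p :+ q) :- p := q) refl (pot t) _ ⟩
      sum (λ a → sum λ b → pathTerm T s t a b) ∎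
      where
      open ≡-Reasoning
      at-s : sum (λ a → sum λ b → pathTerm T s s a b) ≡ 0ℚ
      at-s = sum-zero λ a → sum-zero λ b →
        ⟦⟧-no (edge? T a b ×-dec crosses? (toggle T a b) s a b s) λ (_ , _ , _ , ¬p) → ¬p here

  -- For a simple graph this is the k-th entry of `pot` times the Laplacian, written through
  -- differences along the edges at k.
  divergence : AdjMat n → Fin n → ℚ
  divergence A k = sum λ i → ⟦ edge? A k i ⟧ (pot k - pot i)

  -- Flow across a cut

  module _ (A : AdjMat n) (A-simple : IsSimple A) where

    divergence-pointwise : ∀ i j → ⟦ edge? A i j ⟧ (pot i - pot j) ≡ ⟦ edge? A i j ⟧ pot i + - ⟦ edge? A j i ⟧ pot j
    divergence-pointwise i j = begin
      ⟦ edge? A i j ⟧ (pot i - pot j)                         ≡⟨ ⟦⟧-+ (edge? A i j) (pot i) (- pot j) ⟩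
      ⟦ edge? A i j ⟧ pot i + ⟦ edge? A i j ⟧ (- pot j)       ≡⟨ cong (⟦ edge? A i j ⟧ pot i +_) (⟦⟧-neg (edge? A i j) (pot j)) ⟩
      ⟦ edge? A i j ⟧ pot i + - ⟦ edge? A i j ⟧ pot j
        ≡⟨ cong (λ q → ⟦ edge? A i j ⟧ pot i + - q) (⟦⟧-⇔ (edge? A i j) (edge? A j i) (edge-sym {M = A} (proj₁ A-simple)) (edge-sym {M = A} (proj₁ A-simple))) ⟩
      ⟦ edge? A i j ⟧ pot i + - ⟦ edge? A j i ⟧ pot j ∎
      where open ≡-Reasoning

    -- Each edge occurs in both orientations with opposite signs; this is the vanishing sum of the
    -- columns of the Laplacian, applied to `pot`.
    divergence-total : sum (divergence A) ≡ 0ℚ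
    divergence-total = trans
      (sum-cong-≗ λ i → sum-cong-≗ (divergence-pointwise i))
      (sum-antisym λ i j → ⟦ edge? A i j ⟧ pot i)

    module _ {χ : Fin n → Set} (χ? : ∀ v → Dec (χ v)) where

      -- The same cancellation over the edges inside χ, a condition symmetric in a and b.
      inner-zero : sum (λ a → sum λ b → ⟦ χ? a ⟧ ⟦ χ? b ⟧ ⟦ edge? A a b ⟧ (pot a - pot b)) ≡ 0ℚ
      inner-zero = trans (sum-cong-≗ λ a → sum-cong-≗ (pointwise a))
        (sum-antisym λ a b → ⟦ χ? a ⟧ ⟦ χ? b ⟧ ⟦ edge? A a b ⟧ pot a)
        where
        swap : ∀ a b q → ⟦ χ? a ⟧ ⟦ χ? b ⟧ q ≡ ⟦ χ? b ⟧ ⟦ χ? a ⟧ q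
        swap a b q with does (χ? a) | does (χ? b)
        ... | true  | true  = refl
        ... | true  | false = refl
        ... | false | true  = refl
        ... | false | false = refl
        pointwise : ∀ a b → ⟦ χ? a ⟧ ⟦ χ? b ⟧ ⟦ edge? A a b ⟧ (pot a - pot b) ≡
          ⟦ χ? a ⟧ ⟦ χ? b ⟧ ⟦ edge? A a b ⟧ pot a + - ⟦ χ? b ⟧ ⟦ χ? a ⟧ ⟦ edge? A b a ⟧ pot b
        pointwise a b = begin
          ⟦ χ? a ⟧ ⟦ χ? b ⟧ ⟦ edge? A a b ⟧ (pot a - pot b)
            ≡⟨ cong (λ q → ⟦ χ? a ⟧ ⟦ χ? b ⟧ q) (divergence-pointwise a b) ⟩
          ⟦ χ? a ⟧ ⟦ χ? b ⟧ (p + - q)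
            ≡⟨ cong (λ r → ⟦ χ? a ⟧ r) (trans (⟦⟧-+ (χ? b) p (- q)) (cong (⟦ χ? b ⟧ p +_) (⟦⟧-neg (χ? b) q))) ⟩
          ⟦ χ? a ⟧ (⟦ χ? b ⟧ p + - ⟦ χ? b ⟧ q)
            ≡⟨ trans (⟦⟧-+ (χ? a) (⟦ χ? b ⟧ p) _) (cong (⟦ χ? a ⟧ ⟦ χ? b ⟧ p +_) (⟦⟧-neg (χ? a) (⟦ χ? b ⟧ q))) ⟩
          ⟦ χ? a ⟧ ⟦ χ? b ⟧ p + - ⟦ χ? a ⟧ ⟦ χ? b ⟧ q
            ≡⟨ cong (λ r → ⟦ χ? a ⟧ ⟦ χ? b ⟧ p + - r) (swap a b q) ⟩
          ⟦ χ? a ⟧ ⟦ χ? b ⟧ p + - ⟦ χ? b ⟧ ⟦ χ? a ⟧ q ∎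
          where
          open ≡-Reasoning
          p = ⟦ edge? A a b ⟧ pot a
          q = ⟦ edge? A b a ⟧ pot b

      -- Edges inside χ cancel by `inner-zero`, so only the flow out of χ remains of the divergences
      -- summed over χ.
      cut-flow : sum (λ a → sum λ b → ⟦ χ? a ⟧ ⟦ ¬? (χ? b) ⟧ ⟦ edge? A a b ⟧ (pot a - pot b)) ≡
                 sum (λ a → ⟦ χ? a ⟧ divergence A a)
      cut-flow = begin
        outer                               ≡⟨ ℚ.+-identityˡ outer ⟨
        0ℚ + outer                          ≡⟨ cong (_+ outer) inner-zero ⟨
        inner + outer
          ≡⟨ trans (sum-cong-≗ λ a → ∑-distrib-+ (λ b → ⟦ χ? a ⟧ ⟦ χ? b ⟧ f a b) _) (∑-distrib-+ (λ a → sum λ b → ⟦ χ? a ⟧ ⟦ χ? b ⟧ f a b) _) ⟨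
        sum (λ a → sum λ b → ⟦ χ? a ⟧ ⟦ χ? b ⟧ f a b + ⟦ χ? a ⟧ ⟦ ¬? (χ? b) ⟧ f a b)
          ≡⟨ sum-cong-≗ (λ a → sum-cong-≗ λ b →
               trans (cong (λ q → ⟦ χ? a ⟧ q) (⟦⟧-split (χ? b) (f a b))) (⟦⟧-+ (χ? a) (⟦ χ? b ⟧ f a b) _)) ⟨
        sum (λ a → sum λ b → ⟦ χ? a ⟧ f a b)
          ≡⟨ sum-cong-≗ (λ a → ⟦⟧-sum (χ? a) (f a)) ⟨
        sum (λ a → ⟦ χ? a ⟧ divergence A a) ∎
        where
        open ≡-Reasoning
        f : Fin n → Fin n → ℚ
        f a b = ⟦ edge? A a b ⟧ (pot a - pot b)
        inner = sum (λ a → sum λ b → ⟦ χ? a ⟧ ⟦ χ? b ⟧ f a b)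
        outer = sum (λ a → sum λ b → ⟦ χ? a ⟧ ⟦ ¬? (χ? b) ⟧ f a b)

    -- Regrouping the spanning trees by the forests T - ab

    module _ (integral : ∀ k → IsIntegral (divergence A k)) {ts : List (AdjMat n)}
             (ts! : Unique ts) (trees : ∀ {T} → T ∈ ts → IsSpanningTree A T)
             (all-trees : ∀ T → IsSpanningTree A T → T ∈ ts) (s t : Fin n) where
      private
        open DecMembership {A = AdjMat n} (Vec.≡-dec (Vec.≡-dec Bool._≟_)) using (_∈?_)

        -- T - ab = M is encoded as T = `toggle M a b`; requiring ab to be an edge of T makes this
        -- toggle an insertion.
        Reconnects : AdjMat n → Fin n → Fin n → Set
        Reconnects M a b = toggle M a b ∈ ts × Edge (toggle M a b) a b × Crosses M s a b t

        reconnects? : ∀ M a b → Dec (Reconnects M a b)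
        reconnects? M a b = toggle M a b ∈? ts ×-dec edge? (toggle M a b) a b ×-dec crosses? M s a b t

        -- The terms of all pairs (T , e) with T − e = M.
        forestSum : AdjMat n → ℚ
        forestSum M = sum λ a → sum λ b → ⟦ reconnects? M a b ⟧ (pot a - pot b)

        -- One reconnecting edge shows that M is a spanning forest with two components, separating s
        -- from t. By exchange, all edges of A leaving the component of s then reconnect M, so the
        -- sum is the flow out of that component, a sum of integral divergences.
        forestSum-integral : ∀ M → IsIntegral (forestSum M)
        forestSum-integral M with any? (λ a → any? (reconnects? M a))
        ... | no none = ℤ.+ 0 , sum-zero λ a → sum-zero λ b →
          ⟦⟧-no (reconnects? M a b) λ r → none (a , b , r)
        ... | yes (a₀ , b₀ , T₀∈ , e₀ , _ , _ , ¬t) = subst IsIntegral (sym eq)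
          (integral-sum λ a → integral-⟦⟧ (walk? M s a) (integral a))
          where
          pointwise : ∀ a b → ⟦ reconnects? M a b ⟧ (pot a - pot b) ≡
            ⟦ walk? M s a ⟧ ⟦ ¬? (walk? M s b) ⟧ ⟦ edge? A a b ⟧ (pot a - pot b)
          pointwise a b = trans
            (⟦⟧-⇔ (reconnects? M a b) (walk? M s a ×-dec ¬? (walk? M s b) ×-dec edge? A a b)
              (λ (T∈ , e , p , ¬q , _) → p , ¬q , proj₁ (proj₂ (trees T∈)) a b e)
              -- The condition on t mentions neither a nor b, so `¬t` from the one known pair serves
              -- for all pairs.
              (λ (p , ¬q , e) →
                all-trees _ (spanning-tree-exchange {A = A} {M = M} A-simple e₀ (trees T₀∈) e p ¬q) ,
                toggle-present {M = M} (λ f → ¬q (p ◅◅ edge-walk f)) , p , ¬q , ¬t))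
            (trans (⟦⟧-× (walk? M s a) (¬? (walk? M s b) ×-dec edge? A a b) _)
              (cong (λ q → ⟦ walk? M s a ⟧ q) (⟦⟧-× (¬? (walk? M s b)) (edge? A a b) _)))
          eq : forestSum M ≡ sum (λ a → ⟦ walk? M s a ⟧ divergence A a)
          eq = trans (sum-cong-≗ λ a → sum-cong-≗ (pointwise a)) (cut-flow (walk? M s))

        Σₗ-sum₂ : ∀ {X : Set} (xs : List X) (f : X → Fin n → Fin n → ℚ) →
          Σₗ xs (λ x → sum λ a → sum (f x a)) ≡ sum (λ a → sum λ b → Σₗ xs λ x → f x a b)
        Σₗ-sum₂ xs f = trans (Σₗ-sum xs λ x a → sum (f x a)) (sum-cong-≗ λ a → Σₗ-sum xs λ x → f x a)

        -- The trees are traded for all matrices with a membership bracket; then T = `toggle M a b`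
        -- is substituted, so that M stands for T - ab.
        regroup : ∀ a b → Σₗ ts (λ T → pathTerm T s t a b) ≡
                          Σₗ (allMat n) (λ M → ⟦ reconnects? M a b ⟧ (pot a - pot b))
        regroup a b = begin
          Σₗ ts f
            ≡⟨ Σₗ-↭ f (unique-↭ ts! (Unique.filter⁺ (_∈? ts) allMat-unique)
                 (mk⇔ (∈-filter⁺ (_∈? ts) (allMat-complete _)) (proj₂ ∘ ∈-filter⁻ (_∈? ts) {xs = allMat n}))) ⟩
          Σₗ (filter (_∈? ts) (allMat n)) f
            ≡⟨ Σₗ-filter (_∈? ts) (allMat n) f ⟩
          Σₗ (allMat n) (λ M → ⟦ M ∈? ts ⟧ f M)
            ≡⟨ Σₗ-involution (λ M → toggle M a b) (λ M → toggle-involutive M a b) allMat-unique allMat-complete _ ⟩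
          Σₗ (allMat n) (λ M → ⟦ toggle M a b ∈? ts ⟧ f (toggle M a b))
            ≡⟨ Σₗ-cong (allMat n) (λ {M} _ → trans
                 (sym (⟦⟧-× (toggle M a b ∈? ts)
                   (edge? (toggle M a b) a b ×-dec crosses? (toggle (toggle M a b) a b) s a b t) (pot a - pot b)))
                 (cong (λ N → ⟦ toggle M a b ∈? ts ×-dec edge? (toggle M a b) a b ×-dec crosses? N s a b t ⟧ (pot a - pot b))
                   (toggle-involutive M a b))) ⟩
          Σₗ (allMat n) (λ M → ⟦ reconnects? M a b ⟧ (pot a - pot b)) ∎
          where
          open ≡-Reasoning
          f : AdjMat n → ℚ
          f T = pathTerm T s t a b

      count*difference : toℚ (ℤ.+ length ts) * (pot s - pot t) ≡ Σₗ (allMat n) forestSum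
      count*difference = begin
        toℚ (ℤ.+ length ts) * (pot s - pot t)
          ≡⟨ Σₗ-const ts (pot s - pot t) ⟨
        Σₗ ts (λ _ → pot s - pot t)
          ≡⟨ Σₗ-cong ts (λ T∈ → tree-difference {A = A} (trees T∈) s t) ⟩
        Σₗ ts (λ T → sum λ a → sum λ b → pathTerm T s t a b)
          ≡⟨ Σₗ-sum₂ ts (λ T → pathTerm T s t) ⟩
        sum (λ a → sum λ b → Σₗ ts λ T → pathTerm T s t a b)
          ≡⟨ sum-cong-≗ (λ a → sum-cong-≗ (regroup a)) ⟩
        sum (λ a → sum λ b → Σₗ (allMat n) λ M → ⟦ reconnects? M a b ⟧ (pot a - pot b))
          ≡⟨ Σₗ-sum₂ (allMat n) (λ M a b → ⟦ reconnects? M a b ⟧ (pot a - pot b)) ⟨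
        Σₗ (allMat n) forestSum ∎
        where open ≡-Reasoning

      count*difference-integral : IsIntegral (toℚ (ℤ.+ length ts) * (pot s - pot t))
      count*difference-integral = subst IsIntegral (sym count*difference)
        (integral-Σₗ (allMat n) forestSum-integral)

-- The Laplacian simplex

lookup-∷ʳ-inject₁ : {X : Set} (v : Vec X n) (x : X) (i : Fin n) → lookup (v ∷ʳ x) (inject₁ i) ≡ lookup v i
lookup-∷ʳ-inject₁ (y ∷ v) x zero    = refl
lookup-∷ʳ-inject₁ (y ∷ v) x (suc i) = lookup-∷ʳ-inject₁ v x i

lookup-∷ʳ-fromℕ : {X : Set} (v : Vec X n) (x : X) → lookup (v ∷ʳ x) (fromℕ n) ≡ x
lookup-∷ʳ-fromℕ []      x = refl
lookup-∷ʳ-fromℕ (y ∷ v) x = lookup-∷ʳ-fromℕ v x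

Laplacian-diagonal : (A : AdjMat n) (k : Fin n) → Laplacian A k k ≡ ℤ.+ deg A k
Laplacian-diagonal A k with k ≟ k
... | yes _  = refl
... | no k≢k = contradiction refl k≢k

Laplacian-off-diagonal : (A : AdjMat n) {i k : Fin n} → i ≢ k →
  Laplacian A i k ≡ (if lookup (lookup A i) k then -[1+ 0 ] else ℤ.+ 0)
Laplacian-off-diagonal A {i} {k} i≢k with i ≟ k
... | yes i≡k = contradiction i≡k i≢k
... | no _    = refl

toℚ-sumℕ : (f : Fin n → ℕ) → toℚ (ℤ.+ sumℕ f) ≡ sum (λ i → toℚ (ℤ.+ f i))
toℚ-sumℕ {zero}  f = refl
toℚ-sumℕ {suc n} f = trans (toℚ-+ (ℤ.+ f zero) (ℤ.+ sumℕ (f ∘ suc))) (cong (toℚ (ℤ.+ f zero) +_) (toℚ-sumℕ (f ∘ suc)))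

sum-const : (q : ℚ) → sum {n} (λ _ → q) ≡ toℚ (ℤ.+ n) * q
sum-const {zero}  q = sym (ℚ.*-zeroˡ q)
sum-const {suc n} q = begin
  q + sum {n} (λ _ → q)           ≡⟨ cong₂ _+_ (sym (ℚ.*-identityˡ q)) (sum-const {n} q) ⟩
  1ℚ * q + toℚ (ℤ.+ n) * q        ≡⟨ ℚ.*-distribʳ-+ q 1ℚ (toℚ (ℤ.+ n)) ⟨
  (1ℚ + toℚ (ℤ.+ n)) * q          ≡⟨ cong (_* q) (toℚ-+ (ℤ.+ 1) (ℤ.+ n)) ⟨
  toℚ (ℤ.+ suc n) * q             ∎
  where open ≡-Reasoning

⟦edge⟧-b2n : (A : AdjMat n) (k i : Fin n) (q : ℚ) →
  ⟦ edge? A k i ⟧ q ≡ toℚ (ℤ.+ b2n (lookup (lookup A k) i)) * q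
⟦edge⟧-b2n A k i q with lookup (lookup A k) i
... | true  = sym (ℚ.*-identityˡ q)
... | false = sym (ℚ.*-zeroˡ q)

-- The terms `pot k` give the diagonal entry and the terms `- pot i` the off-diagonal ones. Symmetry
-- exchanges row k of A, read by `divergence`, for column k.
divergence-Laplacian : (pot : Fin n → ℚ) {A : AdjMat n} → IsSimple A → ∀ k →
  divergence pot A k ≡ sum (λ i → pot i * toℚ (Laplacian A i k))
divergence-Laplacian {n} pot {A} (A-sym , A-loopless) k = begin
  sum (λ i → ⟦ edge? A k i ⟧ (pot k - pot i))
    ≡⟨ sum-cong-≗ (λ i → trans (⟦⟧-+ (edge? A k i) (pot k) (- pot i)) (cong (⟦ edge? A k i ⟧ pot k +_) (⟦⟧-neg (edge? A k i) (pot i)))) ⟩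
  sum (λ i → ⟦ edge? A k i ⟧ pot k + - ⟦ edge? A k i ⟧ pot i)
    ≡⟨ ∑-distrib-+ (λ i → ⟦ edge? A k i ⟧ pot k) _ ⟩
  sum (λ i → ⟦ edge? A k i ⟧ pot k) + sum (λ i → - ⟦ edge? A k i ⟧ pot i)
    ≡⟨ cong (_+ sum (λ i → - ⟦ edge? A k i ⟧ pot i)) degree ⟩
  sum (λ i → ⟦ i ≟ k ⟧ (toℚ (ℤ.+ deg A k) * pot k)) + sum (λ i → - ⟦ edge? A k i ⟧ pot i)
    ≡⟨ ∑-distrib-+ (λ i → ⟦ i ≟ k ⟧ (toℚ (ℤ.+ deg A k) * pot k)) _ ⟨
  sum (λ i → ⟦ i ≟ k ⟧ (toℚ (ℤ.+ deg A k) * pot k) + - ⟦ edge? A k i ⟧ pot i)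
    ≡⟨ sum-cong-≗ entry ⟨
  sum (λ i → pot i * toℚ (Laplacian A i k)) ∎
  where
  open ≡-Reasoning
  -- The deg(k) copies of `pot k` are gathered at the index i = k, where the diagonal entry stands,
  -- so that the sums can be compared entry by entry.
  degree : sum (λ i → ⟦ edge? A k i ⟧ pot k) ≡ sum (λ i → ⟦ i ≟ k ⟧ (toℚ (ℤ.+ deg A k) * pot k))
  degree = begin
    sum (λ i → ⟦ edge? A k i ⟧ pot k)
      ≡⟨ sum-cong-≗ (λ i → ⟦edge⟧-b2n A k i (pot k)) ⟩
    sum (λ i → toℚ (ℤ.+ b2n (lookup (lookup A k) i)) * pot k)
      ≡⟨ sum-*ʳ (λ i → toℚ (ℤ.+ b2n (lookup (lookup A k) i))) (pot k) ⟩
    sum (λ i → toℚ (ℤ.+ b2n (lookup (lookup A k) i))) * pot k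
      ≡⟨ cong (_* pot k) (toℚ-sumℕ λ i → b2n (lookup (lookup A k) i)) ⟨
    toℚ (ℤ.+ deg A k) * pot k
      ≡⟨ sum-δ k _ ⟨
    sum (λ i → ⟦ i ≟ k ⟧ (toℚ (ℤ.+ deg A k) * pot k)) ∎
  entry : ∀ i → pot i * toℚ (Laplacian A i k) ≡ ⟦ i ≟ k ⟧ (toℚ (ℤ.+ deg A k) * pot k) + - ⟦ edge? A k i ⟧ pot i
  entry i = by-cases (i ≟ k)
    where
    by-cases : Dec (i ≡ k) → pot i * toℚ (Laplacian A i k) ≡ ⟦ i ≟ k ⟧ (toℚ (ℤ.+ deg A k) * pot k) + - ⟦ edge? A k i ⟧ pot i
    by-cases (yes refl) = trans (cong (λ z → pot k * toℚ z) (Laplacian-diagonal A k)) (trans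
      (ℚ.*-comm (pot k) (toℚ (ℤ.+ deg A k))) (sym (trans
      (cong₂ (λ p q → p + - q) (⟦⟧-yes (k ≟ k) refl) (⟦⟧-no (edge? A k k) no-loop))
      (ℚ.+-identityʳ (toℚ (ℤ.+ deg A k) * pot k)))))
      where
      no-loop : ¬ Edge A k k
      no-loop e with trans (sym e) (A-loopless k)
      ... | ()
    by-cases (no i≢k) = trans (cong (λ z → pot i * toℚ z) (Laplacian-off-diagonal A i≢k)) (trans
      (off (lookup (lookup A i) k)) (sym (trans
      (cong₂ (λ p q → p + - q) (⟦⟧-no (i ≟ k) i≢k)
        (⟦⟧-⇔ (edge? A k i) (edge? A i k) (trans (A-sym i k)) (trans (A-sym k i))))
      (ℚ.+-identityˡ (- ⟦ edge? A i k ⟧ pot i)))))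
      where
      off : ∀ b → pot i * toℚ (if b then -[1+ 0 ] else ℤ.+ 0) ≡ - ⟦ b Bool.≟ true ⟧ pot i
      off true  = trans (sym (ℚ.neg-distribʳ-* (pot i) 1ℚ)) (cong -_ (ℚ.*-identityʳ (pot i)))
      off false = ℚ.*-zeroʳ (pot i)

-- Integrality of nτλ for λ in Λ

module _ {m : ℕ} (A : AdjMat (suc m)) (A-simple : IsSimple A) (pot : Fin (suc m) → ℚ)
         (inΛ : ∀ k → IsIntegral (sumℚ λ i → pot i * toℚ (lookup (AugRow A i) k))) where

  private
    inΛ′ : ∀ k → IsIntegral (sum λ i → pot i * toℚ (lookup (AugRow A i) k))
    inΛ′ k = subst IsIntegral (sumℚ≡sum λ i → pot i * toℚ (lookup (AugRow A i) k)) (inΛ k)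

  -- The appended column of ones turns the last condition of Λ into this.
  total-integral : IsIntegral (sum pot)
  total-integral = subst IsIntegral
    (sum-cong-≗ λ i → trans (cong (λ z → pot i * toℚ z) (lookup-∷ʳ-fromℕ (LnRow A i) (ℤ.+ 1))) (ℚ.*-identityʳ (pot i)))
    (inΛ′ (fromℕ m))

  private
    init-integral : ∀ j → IsIntegral (divergence pot A (inject₁ j))
    init-integral j = subst IsIntegral
      (trans (sum-cong-≗ λ i → cong (λ z → pot i * toℚ z)
               (trans (lookup-∷ʳ-inject₁ (LnRow A i) (ℤ.+ 1) j) (lookup∘tabulate _ j)))
             (sym (divergence-Laplacian pot A-simple (inject₁ j))))
      (inΛ′ (inject₁ j))

  -- The divergences add up to zero, so the entry for the deleted n-th column is minus the sum of
  -- the others, which are integral by the conditions of Λ.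
  divergence-integral : ∀ k → IsIntegral (divergence pot A k)
  divergence-integral k with view k
  ... | ‵inject₁ j = init-integral j
  ... | ‵fromℕ = subst IsIntegral last≡ (integral-neg (integral-sum init-integral))
    where
    D = divergence pot A
    last≡ : - sum (λ j → D (inject₁ j)) ≡ D (fromℕ m)
    last≡ = begin
      - Σinit                      ≡⟨ ℚ.+-identityˡ (- Σinit) ⟨
      0ℚ - Σinit                   ≡⟨ cong (_- Σinit) (divergence-total pot A A-simple) ⟨
      sum D - Σinit                ≡⟨ cong (_- Σinit) (sum-init-last D) ⟩
      (Σinit + D (fromℕ m)) - Σinit ≡⟨ solve 2 (λ p q → (p :+ q) :- p := q) refl Σinit (D (fromℕ m)) ⟩
      D (fromℕ m)                  ∎
      where
      open ≡-Reasoning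
      Σinit = sum λ j → D (inject₁ j)

  module _ {ts : List (AdjMat (suc m))} (ts! : Unique ts) (trees : ∀ {T} → T ∈ ts → IsSpanningTree A T)
           (all-trees : ∀ T → IsSpanningTree A T → T ∈ ts) where

    scaled-integral : ∀ s → IsIntegral (pot s * toℚ (ℤ.+ (suc m ℕ.* length ts)))
    scaled-integral s = subst IsIntegral eq (integral-+
      (integral-sum (count*difference-integral pot A A-simple divergence-integral ts! trees all-trees s))
      (integral-* total-integral (ℤ.+ length ts , refl)))
      where
      open ≡-Reasoning
      τ = toℚ (ℤ.+ length ts)
      eq : sum (λ t → τ * (pot s - pot t)) + sum pot * τ ≡ pot s * toℚ (ℤ.+ (suc m ℕ.* length ts))
      eq = begin
        sum (λ t → τ * (pot s - pot t)) + sum pot * τ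
          ≡⟨ cong (sum (λ t → τ * (pot s - pot t)) +_) (sum-*ʳ pot τ) ⟨
        sum (λ t → τ * (pot s - pot t)) + sum (λ t → pot t * τ)
          ≡⟨ ∑-distrib-+ (λ t → τ * (pot s - pot t)) (λ t → pot t * τ) ⟨
        sum (λ t → τ * (pot s - pot t) + pot t * τ)
          ≡⟨ sum-cong-≗ (λ t → solve 3 (λ c p q → c :* (p :- q) :+ q :* c := p :* c) refl τ (pot s) (pot t)) ⟩
        sum {suc m} (λ t → pot s * τ)
          ≡⟨ sum-const {suc m} (pot s * τ) ⟩
        toℚ (ℤ.+ suc m) * (pot s * τ)
          ≡⟨ solve 3 (λ c p q → c :* (p :* q) := p :* (c :* q)) refl (toℚ (ℤ.+ suc m)) (pot s) τ ⟩
        pot s * (toℚ (ℤ.+ suc m) * τ)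
          ≡⟨ cong (pot s *_) (toℚ-* (ℤ.+ suc m) (ℤ.+ length ts)) ⟨
        pot s * toℚ (ℤ.+ suc m ℤ.* ℤ.+ length ts)
          ≡⟨ cong (λ z → pot s * toℚ z) (ℤ.pos-* (suc m) (length ts)) ⟨
        pot s * toℚ (ℤ.+ (suc m ℕ.* length ts)) ∎

-- Clearing denominators

toℚ-dot : (pot : Fin n → ℚ) (x row : Fin n → ℤ) (N : ℤ) → (∀ i → pot i * toℚ N ≡ toℚ (x i)) →
  toℚ (sumℤ λ i → x i ℤ.* row i) ≡ sumℚ (λ i → pot i * toℚ (row i)) * toℚ N
toℚ-dot pot x row N eq = begin
  toℚ (sumℤ λ i → x i ℤ.* row i)
    ≡⟨ toℚ-sumℤ (λ i → x i ℤ.* row i) ⟩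
  sum (λ i → toℚ (x i ℤ.* row i))
    ≡⟨ sum-cong-≗ (λ i → trans (toℚ-* (x i) (row i)) (cong (_* toℚ (row i)) (sym (eq i)))) ⟩
  sum (λ i → pot i * toℚ N * toℚ (row i))
    ≡⟨ sum-cong-≗ (λ i → solve 3 (λ p c q → p :* c :* q := p :* q :* c) refl (pot i) (toℚ N) (toℚ (row i))) ⟩
  sum (λ i → pot i * toℚ (row i) * toℚ N)
    ≡⟨ sum-*ʳ (λ i → pot i * toℚ (row i)) (toℚ N) ⟩
  sum (λ i → pot i * toℚ (row i)) * toℚ N
    ≡⟨ cong (_* toℚ N) (sumℚ≡sum λ i → pot i * toℚ (row i)) ⟨
  sumℚ (λ i → pot i * toℚ (row i)) * toℚ N ∎
  where open ≡-Reasoning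

*-cancelʳ-pos : ∀ r .{{_ : ℚ.Positive r}} {p q} → p * r ≡ q * r → p ≡ q
*-cancelʳ-pos r eq = ℚ.≤-antisym
  (ℚ.*-cancelʳ-≤-pos r (ℚ.≤-reflexive eq)) (ℚ.*-cancelʳ-≤-pos r (ℚ.≤-reflexive (sym eq)))

toℚ-positive : ∀ {z} → ℤ.+ 0 ℤ.< z → ℚ.Positive (toℚ z)
toℚ-positive 0<z = ℚ.positive (toℚ-mono-< 0<z)

theorem3p6 : (m : ℕ) (A : AdjMat (suc m)) (τ : ℕ) →
    IsSimple A → IsConnected A → HasSpanningTreeCount A τ →
    (λv : Fin (suc m) → ℚ) → InΛ A λv ⇔ InRHS A τ λv
theorem3p6 m A τ A-simple A-conn (ts , ts! , trees , all-trees , refl) λv = mk⇔ to from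
  where
  N = suc m ℕ.* τ

  column : Fin (suc m) → Fin (suc m) → ℤ
  column k i = lookup (AugRow A i) k

  -- The list of all spanning trees is nonempty because a connected graph has one; hence N > 0.
  0<τ : 0 ℕ.< length ts
  0<τ = ∈-length (all-trees _ (proj₂ (spanning-tree-exists A-simple A-conn)))

  to : InΛ A λv → InRHS A τ λv
  to (bounds , inΛ) = num , num-bounds , num-divisible , num-eq
    where
    -- The numerators exist because Nλ is integral; the rest of this inclusion clears denominators.
    integral : ∀ i → IsIntegral (λv i * toℚ (ℤ.+ N))
    integral = scaled-integral A A-simple λv inΛ ts! (All.lookup trees) all-trees
    num : Fin (suc m) → ℤ
    num i = proj₁ (integral i)
    num-eq : ∀ i → λv i * toℚ (ℤ.+ N) ≡ toℚ (num i)
    num-eq i = proj₂ (integral i)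
    instance
      N-pos : ℚ.Positive (toℚ (ℤ.+ N))
      N-pos = toℚ-positive (ℤ.+<+ (ℕ.*-mono-< (ℕ.z<s {m}) 0<τ))
      N-nonNeg : ℚ.NonNegative (toℚ (ℤ.+ N))
      N-nonNeg = ℚ.pos⇒nonNeg (toℚ (ℤ.+ N))
    num-bounds : ∀ i → (ℤ.+ 0 ℤ.≤ num i) × (num i ℤ.< ℤ.+ N)
    num-bounds i =
      toℚ-cancel-≤ (subst₂ ℚ._≤_ (ℚ.*-zeroˡ (toℚ (ℤ.+ N))) (num-eq i)
        (ℚ.*-monoʳ-≤-nonNeg (toℚ (ℤ.+ N)) (proj₁ (bounds i)))) ,
      toℚ-cancel-< (subst₂ ℚ._<_ (num-eq i) (ℚ.*-identityˡ (toℚ (ℤ.+ N)))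
        (ℚ.*-monoˡ-<-pos (toℚ (ℤ.+ N)) (proj₂ (bounds i))))
    num-divisible : ∀ k → ℤ.+ N ℤᵤ.∣ sumℤ (λ i → num i ℤ.* lookup (AugRow A i) k)
    -- With x = Nλ, the product of x with column k is N times the integer `z`, the product of λ with
    -- that column.
    num-divisible k = let z , eq = inΛ k in
      ∣⇒∣ᵤ {ℤ.+ N} {sumℤ (λ i → num i ℤ.* column k i)} (divides z (toℚ-injective {sumℤ (λ i → num i ℤ.* column k i)} {z ℤ.* ℤ.+ N} (trans (toℚ-dot λv num (column k) (ℤ.+ N) num-eq)
        (trans (cong (_* toℚ (ℤ.+ N)) eq) (sym (toℚ-* z (ℤ.+ N)))))))

  from : InRHS A τ λv → InΛ A λv
  from (num , bounds , divisible , num-eq) = λ-bounds , inΛ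
    where
    instance
      N-pos : ℚ.Positive (toℚ (ℤ.+ N))
      -- N > 0 is read off from 0 ≤ x < N in the first coordinate.
      N-pos = toℚ-positive (ℤ.≤-<-trans (proj₁ (bounds zero)) (proj₂ (bounds zero)))
      N-nonNeg : ℚ.NonNegative (toℚ (ℤ.+ N))
      N-nonNeg = ℚ.pos⇒nonNeg (toℚ (ℤ.+ N))
    λ-bounds : ∀ i → (0ℚ ℚ.≤ λv i) × (λv i ℚ.< 1ℚ)
    λ-bounds i =
      ℚ.*-cancelʳ-≤-pos (toℚ (ℤ.+ N)) (subst₂ ℚ._≤_ (sym (ℚ.*-zeroˡ (toℚ (ℤ.+ N)))) (sym (num-eq i))
        (toℚ-mono-≤ (proj₁ (bounds i)))) ,
      ℚ.*-cancelʳ-<-nonNeg (toℚ (ℤ.+ N)) (subst₂ ℚ._<_ (sym (num-eq i)) (sym (ℚ.*-identityˡ (toℚ (ℤ.+ N))))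
        (toℚ-mono-< (proj₂ (bounds i))))
    inΛ : ∀ k → IsIntegral (sumℚ λ i → λv i * toℚ (lookup (AugRow A i) k))
    -- The integral value is the quotient `q` of the divisibility, obtained by cancelling N > 0.
    inΛ k with ∣ᵤ⇒∣ {ℤ.+ N} {sumℤ (λ i → num i ℤ.* column k i)} (divisible k)
    ... | divides q eq = q , *-cancelʳ-pos (toℚ (ℤ.+ N))
      (trans (sym (toℚ-dot λv num (column k) (ℤ.+ N) num-eq)) (trans (cong toℚ eq) (toℚ-* q (ℤ.+ N))))
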